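{- Let $p$ be a prime number, let $s$ be a positive divisor of $p-1$, and let $\mathbb{K}$ be the unique subfield of $\mathbb{Q}(\zeta_p)$ with $[\mathbb{K}:\mathbb{Q}]=s$. Let $\tilde{\mathcal{M}}_p\subseteq\mathcal{O}_{\mathbb{K}}$ be the $\mathbb{Z}$-submodule defined in the context. Then the index of $\tilde{\mathcal{M}}_p$ in $\mathcal{O}_{\mathbb{K}}$ is given by $$[\mathcal{O}_{\mathbb{K}}:\tilde{\mathcal{M}}_p]=\begin{cases} 2p^{\frac{s+1}{2}} & \text{if } s\equiv 1\pmod 2,\\ 2p^{\frac{s+2}{2}} & \text{if } s\equiv 0\pmod 2.\end{cases}$$
   Context: Here $\zeta_p$ is a primitive $p$-th root of unity, $\mathbb{L}=\mathbb{Q}(\zeta_p)$, and $\mathcal{O}_{\mathbb{K}}$ is the ring of algebraic integers of $\mathbb{K}$. Let $u$ be an integer whose class generates $(\mathbb{Z}/p\mathbb{Z})^{\star}$, let $\sigma_u$ be the automorphism of $\mathbb{L}$ with $\sigma_u(\zeta_p)=\zeta_p^u$, let $\theta=\sigma_u|_{\mathbb{K}}$ (a generator of $\mathrm{Gal}(\mathbb{K}/\mathbb{Q})$), and let $t=\mathrm{Tr}_{\mathbb{L}/\mathbb{K}}(\zeta_p)$. The map $(a_0,\ldots,a_{s-1})\mapsto\sum_{i=0}^{s-1}a_i\theta^i(t)$ is an isomorphism of $\mathbb{Z}$-modules $\mathbb{Z}^s\to\mathcal{O}_{\mathbb{K}}$, and through it elements ${\bf x}\in\mathcal{O}_{\mathbb{K}}$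 are identified with their coordinate vectors ${\bf x}=(a_0,\ldots,a_{s-1})\in\mathbb{Z}^s$. Let $\beta\in\mathbb{Z}$ be a primitive root modulo $p$ (of multiplicative order $p-1$ modulo $p$), and put $\alpha=\beta^{(p-1)/s}$. For $i=0,1,\ldots,s-1$ let $\mu_i=(1,\alpha^i,\alpha^{2i},\ldots,\alpha^{(s-1)i})\in\mathbb{Z}^s$, and let $\cdot$ denote the usual dot product on $\mathbb{Z}^s$. Define: if $s$ is odd, $\mathcal{M}_p=\{{\bf x}\in\mathcal{O}_{\mathbb{K}}:{\bf x}\cdot\mu_i\equiv 0\pmod p\text{ for all } i=0,1,\ldots,\frac{s-1}{2}\}$; if $s$ is even, $\mathcal{M}_p=\{{\bf x}\in\mathcal{O}_{\mathbb{K}}:{\bf x}\cdot\mu_i\equiv 0\pmod p\text{ for all } i=0,1,\ldots,\frac{s}{2}\}$. In both cases, $\tilde{\mathcal{M}}_p=\{{\bf x}=(a_0,\ldots,a_{s-1})\in\mathcal{M}_p:\sum_{i=0}^{s-1}a_i\equiv 0\pmod 2\}$.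
   Formalization: The prime p is assumed to be different from 2: for p = 2 one has s = 1 and the submodule is 2ℤ in ℤ, of index 2, whereas the stated formula would give 4. -}

module Defs where

open import Algebra.Apartness.Bundles using (HeytingField)
open import Algebra.Bundles using (CommutativeRing)
open import Algebra.Morphism.Structures using (IsRingHomomorphism; IsRingIsomorphism)
import Algebra.Properties.Semiring.Exp as Exp
import Algebra.Properties.Semiring.Sum as Sum
open import Data.Fin.Base using (Fin; toℕ)
open import Data.Integer.Base as ℤ using (ℤ; +_; 1ℤ)
open import Data.Integer.Divisibility using (_∣_)
import Data.Integer.Properties as ℤ
open import Data.Nat.Base as ℕ using (ℕ; NonZero; _<_; _≤_; _∸_)
import Data.Nat.DivMod as ℕ
open import Data.Nat.GeneralisedArithmetic using (iterate)
open import Data.Product.Base using (Σ-syntax; ∃; ∃-syntax; _×_; _,_; proj₁)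
open import Data.Rational.Base as ℚ using (ℚ)
open import Data.Vec.Functional using (Vector)
open import Function.Definitions using (Congruent; Bijective)
open import Level using (_⊔_)
open import Relation.Binary.Core using (Rel)
open import Relation.Binary.PropositionalEquality using (_≡_; _≗_)
open import Relation.Nullary.Negation using (¬_)
open import Relation.Unary using (Pred; _∈_; U)

infix 4 _≡_mod_

_≡_mod_ : ℤ → ℤ → ℕ → Set
x ≡ y mod n = + n ∣ x ℤ.- y

-- The class of u generates (ℤ/p)^×.  As this group is finite (p prime),
-- natural number exponents suffice.
GeneratesUnits : ℕ → ℤ → Set
GeneratesUnits p u =
  ¬ (+ p ∣ u) × (∀ a → ¬ (+ p ∣ a) → ∃[ k ] (u ℤ.^ k) ≡ a mod p)

-- β has multiplicative order exactly p - 1 modulo p.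
IsPrimitiveRoot : ℕ → ℤ → Set
IsPrimitiveRoot p β =
  (β ℤ.^ (p ∸ 1)) ≡ 1ℤ mod p ×
  (∀ k → 0 < k → k < p ∸ 1 → ¬ ((β ℤ.^ k) ≡ 1ℤ mod p))

module ℤ-Sum = Sum (CommutativeRing.semiring ℤ.+-*-commutativeRing)

infix 7 _·_

_·_ : ∀ {s} → Vector ℤ s → Vector ℤ s → ℤ
a · b = ℤ-Sum.sum (λ j → a j ℤ.* b j)

module _ (p s : ℕ) .{{_ : NonZero s}} (β : ℤ) where

  α : ℤ
  α = β ℤ.^ ((p ∸ 1) ℕ./ s)

  μ : ℕ → Vector ℤ s
  μ i j = α ℤ.^ (toℕ j ℕ.* i)

  -- 𝓜 and 𝓜̃ in coordinates; see ⟦_⟧ below for the submodules of 𝓞.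
  𝓜 : Pred (Vector ℤ s) _
  𝓜 a =
    (s ℕ.% 2 ≡ 1 → ∀ i → i ≤ (s ∸ 1) ℕ./ 2 → a · μ i ≡ + 0 mod p) ×
    (s ℕ.% 2 ≡ 0 → ∀ i → i ≤ s ℕ./ 2       → a · μ i ≡ + 0 mod p)

  𝓜̃ : Pred (Vector ℤ s) _
  𝓜̃ a = a ∈ 𝓜 × ℤ-Sum.sum a ≡ + 0 mod 2

-- L is a field containing ℚ by way of ι.  Intermediate fields, their rings of
-- integers and submodules of the latter are all represented as predicates
-- on L.
module _ {c ℓ₁ ℓ₂} (L : HeytingField c ℓ₁ ℓ₂) (ι : ℚ → HeytingField.Carrier L) where

  open HeytingField L

  private
    ring : CommutativeRing c ℓ₁
    ring = record { isCommutativeRing = isCommutativeRing }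

  open CommutativeRing ring using (semiring; rawRing)
  open Exp semiring using (_^_)
  open Sum semiring using (sum)

  ιℤ : ℤ → Carrier
  ιℤ n = ι (n ℚ./ 1)

  -- The smallest subfield containing ζ: closure under the field operations.
  data ℚ⟨_⟩ (ζ : Carrier) : Pred Carrier (c ⊔ ℓ₁) where
    rational  : ∀ q → ι q ∈ ℚ⟨ ζ ⟩
    generator : ζ ∈ ℚ⟨ ζ ⟩
    add       : ∀ {x y} → x ∈ ℚ⟨ ζ ⟩ → y ∈ ℚ⟨ ζ ⟩ → x + y ∈ ℚ⟨ ζ ⟩
    negate    : ∀ {x} → x ∈ ℚ⟨ ζ ⟩ → - x ∈ ℚ⟨ ζ ⟩
    multiply  : ∀ {x y} → x ∈ ℚ⟨ ζ ⟩ → y ∈ ℚ⟨ ζ ⟩ → x * y ∈ ℚ⟨ ζ ⟩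
    invert    : ∀ {x y} → x * y ≈ 1# → x ∈ ℚ⟨ ζ ⟩ → y ∈ ℚ⟨ ζ ⟩
    respect   : ∀ {x y} → x ≈ y → x ∈ ℚ⟨ ζ ⟩ → y ∈ ℚ⟨ ζ ⟩

  -- L = ℚ(ζ) with ζ a primitive p-th root of unity.
  record IsCyclotomic (p : ℕ) (ζ : Carrier) : Set (c ⊔ ℓ₁) where
    field
      ι-homomorphism : IsRingHomomorphism ℚ.+-*-rawRing rawRing ι
      ζ^p≈1          : ζ ^ p ≈ 1#
      ζ^k≉1          : ∀ k → 0 < k → k < p → ¬ (ζ ^ k ≈ 1#)
      generated      : ∀ x → x ∈ ℚ⟨ ζ ⟩

  record IsSubfield {k} (K : Pred Carrier k) : Set (c ⊔ ℓ₁ ⊔ k) where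
    field
      ≈-closed  : ∀ {x y} → x ≈ y → x ∈ K → y ∈ K
      1-closed  : 1# ∈ K
      +-closed  : ∀ {x y} → x ∈ K → y ∈ K → x + y ∈ K
      -‿closed  : ∀ {x} → x ∈ K → - x ∈ K
      *-closed  : ∀ {x y} → x ∈ K → y ∈ K → x * y ∈ K
      ⁻¹-closed : ∀ {x y} → x * y ≈ 1# → x ∈ K → y ∈ K

  ℚ-in-L : Pred Carrier ℓ₁
  ℚ-in-L x = ∃[ q ] x ≈ ι q

  -- e is a basis of V as a vector space over the subfield F.
  record IsBasis {f v} (F : Pred Carrier f) (V : Pred Carrier v)
                 {n} (e : Vector Carrier n) : Set (c ⊔ ℓ₁ ⊔ f ⊔ v) where
    field
      member      : ∀ i → e i ∈ V
      spanning    : ∀ x → x ∈ V →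
                    Σ[ a ∈ Vector Carrier n ]
                      (∀ i → a i ∈ F) × x ≈ sum (λ i → a i * e i)
      independent : ∀ (a : Vector Carrier n) → (∀ i → a i ∈ F) →
                    sum (λ i → a i * e i) ≈ 0# → ∀ i → a i ≈ 0#

  HasDegreeOverℚ : ∀ {k} → Pred Carrier k → ℕ → Set (c ⊔ ℓ₁ ⊔ k)
  HasDegreeOverℚ K n = Σ[ e ∈ Vector Carrier n ] IsBasis ℚ-in-L K e

  -- t = Tr_{L/K}(x): the trace of the matrix m over K of multiplication by x
  -- with respect to a K-basis e of L.
  record IsTrace {k} (K : Pred Carrier k) (x t : Carrier) : Set (c ⊔ ℓ₁ ⊔ k) where
    field
      {n}       : ℕ
      e         : Vector Carrier n
      isBasis   : IsBasis K U e
      m         : Fin n → Fin n → Carrier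
      m∈K       : ∀ i j → m i j ∈ K
      isMatrix  : ∀ j → x * e j ≈ sum (λ i → m i j * e i)
      t≈trace   : t ≈ sum (λ i → m i i)

  -- σ is the automorphism of L with σ(ζ) = ζ^u.  Since u may be negative and
  -- ζ^p = 1, the power ζ^u is written with natural number exponents m ≡ u.
  record IsGaloisAutomorphism (p : ℕ) (ζ : Carrier) (u : ℤ)
                              (σ : Carrier → Carrier) : Set (c ⊔ ℓ₁) where
    field
      isRingIsomorphism : IsRingIsomorphism rawRing rawRing σ
      σζ≈ζ^u            : ∀ m → + m ≡ u mod p → σ ζ ≈ ζ ^ m

  IsIntegral : Pred Carrier ℓ₁
  IsIntegral x = ∃[ n ] Σ[ a ∈ Vector ℤ n ]
    x ^ n + sum (λ i → ιℤ (a i) * x ^ toℕ i) ≈ 0#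

  𝓞 : ∀ {k} → Pred Carrier k → Pred Carrier (ℓ₁ ⊔ k)
  𝓞 K x = x ∈ K × IsIntegral x

  -- (a₀ , … , aₛ₋₁) ↦ Σ aᵢ θⁱ(t).  For t ∈ K, θⁱ(t) = σⁱ(t) as θ is the
  -- restriction of σ to K.
  fromCoordinates : (Carrier → Carrier) → Carrier → ∀ {s} → Vector ℤ s → Carrier
  fromCoordinates σ t a = sum (λ i → ιℤ (a i) * iterate σ t (toℕ i))

  -- The map above is an isomorphism of ℤ-modules ℤ^s → 𝓞 K; its additivity
  -- is evident from the formula.
  record IsIsomorphismOnto𝓞 {k} (K : Pred Carrier k) (s : ℕ)
                            (σ : Carrier → Carrier) (t : Carrier) : Set (c ⊔ ℓ₁ ⊔ k) where
    field
      integral  : ∀ (a : Vector ℤ s) → fromCoordinates σ t a ∈ 𝓞 K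
      bijective : Bijective {A = Vector ℤ s} {B = ∃ (𝓞 K)}
                    _≗_ (λ x y → proj₁ x ≈ proj₁ y)
                    (λ a → fromCoordinates σ t a , integral a)

  -- The elements of 𝓞 K whose coordinate vector lies in N.
  ⟦_⟧ : ∀ {k r s} → Pred (Vector ℤ s) r →
        Pred Carrier k → (Carrier → Carrier) → Carrier → Pred Carrier (ℓ₁ ⊔ k ⊔ r)
  ⟦ N ⟧ K σ t x = x ∈ 𝓞 K × ∃[ a ] x ≈ fromCoordinates σ t a × a ∈ N

  -- The index of H in G is n: the quotient of G by congruence modulo H is in
  -- bijection with Fin n.
  HasIndex : ∀ {g h} → Pred Carrier g → Pred Carrier h → ℕ → Set (c ⊔ g ⊔ h)
  HasIndex G H n =
    Σ[ f ∈ (∃ G → Fin n) ] Congruent _∼_ _≡_ f × Bijective _∼_ _≡_ f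
    where
    _∼_ : Rel (∃ G) _
    x ∼ y = proj₁ x - proj₁ y ∈ H

-- Coordinates with respect to the θⁱ(t) turn the index into that of a sublattice
-- of ℤˢ cut out by m conditions mod p and one condition mod 2, so it suffices
-- that a ↦ (a · μ₀ , … , a · μₘ₋₁ , Σ aᵢ) is onto (ℤ/p)ᵐ × ℤ/2.  As α has order
-- s mod p and s is invertible mod p, the inverse discrete Fourier transform hits
-- any prescribed residues a · μᵢ mod p; since p is odd, adding a multiple of p to
-- a₀ then corrects the parity.
module Submission where

open import Defs
open import Algebra.Apartness.Bundles using (HeytingField)
open import Algebra.Bundles using (CommutativeRing)
open import Algebra.Morphism.Structures using (IsRingHomomorphism)
import Algebra.Properties.Semiring.Sum as Sum
open import Data.Fin.Base using (Fin; zero; suc; toℕ; fromℕ<; combine; funToFin; finToFun; punchIn)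
import Data.Fin.Properties as Fin
open import Data.Integer.Base as ℤ using (ℤ; +_; 0ℤ; 1ℤ; ∣_∣)
open import Data.Integer.DivMod using (_%ℕ_; _/ℕ_; n%ℕd<d; a≡a%ℕn+[a/ℕn]*n)
import Data.Integer.Divisibility.Signed as ℤ-Signed
import Data.Integer.Properties as ℤ
open import Data.Integer.Tactic.RingSolver using (solve-∀)
open import Data.Nat.Base as ℕ using (ℕ; zero; suc; NonZero; _+_; _*_; _^_; _<_; _≤_; _∸_; s≤s; z≤n)
open import Data.Nat.Divisibility using (_∣_)
import Data.Nat.Divisibility as ℕ
open import Data.Nat.DivMod using (_/_; _%_)
import Data.Nat.DivMod as ℕ
open import Data.Nat.GeneralisedArithmetic using (iterate)
open import Data.Nat.Primality using (Prime; euclidsLemma; prime⇒irreducible; prime⇒nonTrivial; prime⇒nonZero)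
import Data.Nat.Properties as ℕ
open import Data.Product.Base using (Σ-syntax; ∃; ∃-syntax; _×_; _,_; proj₁; proj₂)
open import Data.Rational.Base as ℚ using (ℚ)
import Data.Rational.Properties as ℚ
open import Data.Rational.Unnormalised.Base as ℚᵘ using (mkℚᵘ; *≡*)
import Data.Rational.Unnormalised.Properties as ℚᵘ
open import Data.Sum.Base using (inj₁; inj₂; [_,_]′)
open import Data.Vec.Functional using (Vector)
open import Function.Base using (_∘_)
open import Relation.Binary.Definitions using (tri<; tri≈; tri>)
open import Relation.Binary.PropositionalEquality
  using (_≡_; _≢_; _≗_; refl; sym; trans; cong; cong₂; subst; module ≡-Reasoning)
open import Relation.Nullary.Negation using (¬_; contradiction)
open import Relation.Unary using (Pred)

open ℤ-Sum using (sum)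

-- Linearity of finite integer sums, and geometric sums.

sum-distrib-− : ∀ {n} (a b : Vector ℤ n) → sum (λ i → a i ℤ.- b i) ≡ sum a ℤ.- sum b
sum-distrib-− {zero}  a b = refl
sum-distrib-− {suc n} a b = trans
  (cong (λ x → (a zero ℤ.- b zero) ℤ.+ x) (sum-distrib-− (a ∘ suc) (b ∘ suc)))
  (interchange (a zero) (b zero) (sum (a ∘ suc)) (sum (b ∘ suc)))
  where
  interchange : ∀ w x y z → (w ℤ.- x) ℤ.+ (y ℤ.- z) ≡ (w ℤ.+ y) ℤ.- (x ℤ.+ z)
  interchange = solve-∀

·-distribʳ-− : ∀ {n} (a b c : Vector ℤ n) → (λ i → a i ℤ.- b i) · c ≡ a · c ℤ.- b · c
·-distribʳ-− a b c = trans
  (ℤ-Sum.sum-cong-≗ (λ i → distrib (a i) (b i) (c i)))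
  (sum-distrib-− (λ i → a i ℤ.* c i) (λ i → b i ℤ.* c i))
  where
  distrib : ∀ x y z → (x ℤ.- y) ℤ.* z ≡ x ℤ.* z ℤ.- y ℤ.* z
  distrib = solve-∀

-- Keeping the factor `x - 1` on the left avoids division, so the identity holds in ℤ for every `x`;
-- modulo a prime the factor can be cancelled once it is known not to vanish.
geometric-sum : ∀ x n → (x ℤ.- 1ℤ) ℤ.* sum {n} (λ j → x ℤ.^ toℕ j) ≡ x ℤ.^ n ℤ.- 1ℤ
geometric-sum x zero    = ℤ.*-zeroʳ (x ℤ.- 1ℤ)
geometric-sum x (suc n) = begin
  (x ℤ.- 1ℤ) ℤ.* (1ℤ ℤ.+ sum {n} (λ j → x ℤ.* x ℤ.^ toℕ j))
    ≡⟨ cong (λ S → (x ℤ.- 1ℤ) ℤ.* (1ℤ ℤ.+ S)) (ℤ-Sum.*-distribˡ-sum {n} x _) ⟨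
  (x ℤ.- 1ℤ) ℤ.* (1ℤ ℤ.+ x ℤ.* G)
    ≡⟨ expand x G ⟩
  (x ℤ.- 1ℤ) ℤ.+ x ℤ.* ((x ℤ.- 1ℤ) ℤ.* G)
    ≡⟨ cong (λ S → (x ℤ.- 1ℤ) ℤ.+ x ℤ.* S) (geometric-sum x n) ⟩
  (x ℤ.- 1ℤ) ℤ.+ x ℤ.* (x ℤ.^ n ℤ.- 1ℤ)
    ≡⟨ collect x (x ℤ.^ n) ⟩
  x ℤ.* x ℤ.^ n ℤ.- 1ℤ ∎
  where
  open ≡-Reasoning
  G = sum {n} (λ j → x ℤ.^ toℕ j)
  expand : ∀ x y → (x ℤ.- 1ℤ) ℤ.* (1ℤ ℤ.+ x ℤ.* y) ≡ (x ℤ.- 1ℤ) ℤ.+ x ℤ.* ((x ℤ.- 1ℤ) ℤ.* y)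
  expand = solve-∀
  collect : ∀ x y → (x ℤ.- 1ℤ) ℤ.+ x ℤ.* (y ℤ.- 1ℤ) ≡ x ℤ.* y ℤ.- 1ℤ
  collect = solve-∀

-- Congruence modulo n, and residues as elements of `Fin n`.

module Modular (n : ℕ) where

  infix 4 _≋_

  -- A record, so that unification recovers x and y from a proof.
  record _≋_ (x y : ℤ) : Set where
    constructor congruent
    field difference : + n ℤ-Signed.∣ x ℤ.- y

  ≋⇒≡mod : ∀ {x y} → x ≋ y → x ≡ y mod n
  ≋⇒≡mod (congruent d) = ℤ-Signed.∣⇒∣ᵤ d

  ≡mod⇒≋ : ∀ {x y} → x ≡ y mod n → x ≋ y
  ≡mod⇒≋ d = congruent (ℤ-Signed.∣ᵤ⇒∣ d)

  ≋-refl : ∀ {x} → x ≋ x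
  ≋-refl {x} = congruent (ℤ-Signed.divides 0ℤ (ℤ.+-inverseʳ x))

  ≋-reflexive : ∀ {x y} → x ≡ y → x ≋ y
  ≋-reflexive refl = ≋-refl

  ≋-sym : ∀ {x y} → x ≋ y → y ≋ x
  ≋-sym {x} {y} (congruent d) = congruent (subst (+ n ℤ-Signed.∣_) (lemma x y) (ℤ-Signed.∣m⇒∣-m d))
    where
    lemma : ∀ x y → ℤ.- (x ℤ.- y) ≡ y ℤ.- x
    lemma = solve-∀

  ≋-trans : ∀ {x y z} → x ≋ y → y ≋ z → x ≋ z
  ≋-trans {x} {y} {z} (congruent d) (congruent e) =
    congruent (subst (+ n ℤ-Signed.∣_) (lemma x y z) (ℤ-Signed.∣m∣n⇒∣m+n d e))
    where
    lemma : ∀ x y z → (x ℤ.- y) ℤ.+ (y ℤ.- z) ≡ x ℤ.- z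
    lemma = solve-∀

  +-cong : ∀ {w x y z} → w ≋ x → y ≋ z → w ℤ.+ y ≋ x ℤ.+ z
  +-cong {w} {x} {y} {z} (congruent d) (congruent e) =
    congruent (subst (+ n ℤ-Signed.∣_) (lemma w x y z) (ℤ-Signed.∣m∣n⇒∣m+n d e))
    where
    lemma : ∀ w x y z → (w ℤ.- x) ℤ.+ (y ℤ.- z) ≡ (w ℤ.+ y) ℤ.- (x ℤ.+ z)
    lemma = solve-∀

  *-cong : ∀ {w x y z} → w ≋ x → y ≋ z → w ℤ.* y ≋ x ℤ.* z
  *-cong {w} {x} {y} {z} (congruent d) (congruent e) =
    congruent (subst (+ n ℤ-Signed.∣_) (lemma w x y z)
      (ℤ-Signed.∣m∣n⇒∣m+n (ℤ-Signed.∣m⇒∣m*n y d) (ℤ-Signed.∣n⇒∣m*n x e)))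
    where
    lemma : ∀ w x y z → (w ℤ.- x) ℤ.* y ℤ.+ x ℤ.* (y ℤ.- z) ≡ w ℤ.* y ℤ.- x ℤ.* z
    lemma = solve-∀

  -‿cong : ∀ {x y} → x ≋ y → ℤ.- x ≋ ℤ.- y
  -‿cong {x} {y} (congruent d) = congruent (subst (+ n ℤ-Signed.∣_) (lemma x y) (ℤ-Signed.∣m⇒∣-m d))
    where
    lemma : ∀ x y → ℤ.- (x ℤ.- y) ≡ ℤ.- x ℤ.- (ℤ.- y)
    lemma = solve-∀

  -- The carrier is ℤ itself and only the equality is coarsened. Sums over this ring are therefore
  -- literally the integer sums, and congruences and integer identities mix in one calculation.
  ℤ/n : CommutativeRing _ _
  ℤ/n = record
    { Carrier = ℤ ; _≈_ = _≋_ ; _+_ = ℤ._+_ ; _*_ = ℤ._*_ ; -_ = ℤ.-_ ; 0# = 0ℤ ; 1# = 1ℤ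
    ; isCommutativeRing = record
      { isRing = record
        { +-isAbelianGroup = record
          { isGroup = record
            { isMonoid = record
              { isSemigroup = record
                { isMagma = record
                  { isEquivalence = record { refl = ≋-refl ; sym = ≋-sym ; trans = ≋-trans }
                  ; ∙-cong = +-cong
                  }
                ; assoc = λ x y z → ≋-reflexive (ℤ.+-assoc x y z)
                }
              ; identity = (≋-reflexive ∘ ℤ.+-identityˡ) , (≋-reflexive ∘ ℤ.+-identityʳ)
              }
            ; inverse = (≋-reflexive ∘ ℤ.+-inverseˡ) , (≋-reflexive ∘ ℤ.+-inverseʳ)
            ; ⁻¹-cong = -‿cong
            }
          ; comm = λ x y → ≋-reflexive (ℤ.+-comm x y)
          }
        ; *-cong = *-cong
        ; *-assoc = λ x y z → ≋-reflexive (ℤ.*-assoc x y z)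
        ; *-identity = (≋-reflexive ∘ ℤ.*-identityˡ) , (≋-reflexive ∘ ℤ.*-identityʳ)
        ; distrib = (λ x y z → ≋-reflexive (ℤ.*-distribˡ-+ x y z))
                  , (λ x y z → ≋-reflexive (ℤ.*-distribʳ-+ x y z))
        }
      ; *-comm = λ x y → ≋-reflexive (ℤ.*-comm x y)
      }
    }

  open CommutativeRing ℤ/n public using (setoid; semiring; *-congˡ; *-congʳ; +-congˡ)

  module ℤ/n-Sum = Sum semiring

  ^-congˡ : ∀ {x y} k → x ≋ y → x ℤ.^ k ≋ y ℤ.^ k
  ^-congˡ zero    x≋y = ≋-refl
  ^-congˡ (suc k) x≋y = *-cong x≋y (^-congˡ k x≋y)

  ^-≋1 : ∀ {x} k → x ≋ 1ℤ → x ℤ.^ k ≋ 1ℤ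
  ^-≋1 k x≋1 = ≋-trans (^-congˡ k x≋1) (≋-reflexive (ℤ.^-zeroˡ k))

  ≋⇒-≋0 : ∀ x y → x ≋ y → x ℤ.- y ≋ 0ℤ
  ≋⇒-≋0 x y (congruent d) = congruent (subst (+ n ℤ-Signed.∣_) (sym (ℤ.+-identityʳ (x ℤ.- y))) d)

  -≋0⇒≋ : ∀ x y → x ℤ.- y ≋ 0ℤ → x ≋ y
  -≋0⇒≋ x y (congruent d) = congruent (subst (+ n ℤ-Signed.∣_) (ℤ.+-identityʳ (x ℤ.- y)) d)

  k*n≋0 : ∀ k → k ℤ.* + n ≋ 0ℤ
  k*n≋0 k = congruent (ℤ-Signed.divides k (ℤ.+-identityʳ (k ℤ.* + n)))

  module _ .{{_ : NonZero n}} where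

    -- Realises the quotient of ℤ by `_≋_` as `Fin n`, with `toℕ` choosing the canonical
    -- representative.
    residue : ℤ → Fin n
    residue x = fromℕ< (n%ℕd<d x n)

    toℕ-residue : ∀ x → + toℕ (residue x) ≋ x
    toℕ-residue x = ≋-sym (begin
      x                               ≡⟨ a≡a%ℕn+[a/ℕn]*n x n ⟩
      + (x %ℕ n) ℤ.+ (x /ℕ n) ℤ.* + n ≈⟨ +-congˡ {+ (x %ℕ n)} (k*n≋0 (x /ℕ n)) ⟩
      + (x %ℕ n) ℤ.+ 0ℤ               ≡⟨ ℤ.+-identityʳ _ ⟩
      + (x %ℕ n)                      ≡⟨ cong +_ (Fin.toℕ-fromℕ< (n%ℕd<d x n)) ⟨
      + toℕ (residue x)               ∎)
      where
      open import Relation.Binary.Reasoning.Setoid setoid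

    residue-injective : ∀ {x y} → residue x ≡ residue y → x ≋ y
    residue-injective {x} {y} eq = ≋-trans (≋-sym (toℕ-residue x))
      (≋-trans (≋-reflexive (cong (λ r → + toℕ r) eq)) (toℕ-residue y))

    private
      small : ∀ {k} → n ℕ.∣ k → k < n → k ≡ 0
      small {zero}  _   _   = refl
      small {suc k} n∣k k<n = contradiction (ℕ.∣⇒≤ n∣k) (ℕ.<⇒≱ k<n)

      -- The difference `j ∸ i` is a multiple of `n` smaller than `n`, hence zero.
      +-≋-≤ : ∀ {i j} → i ≤ j → j < n → + i ≋ + j → i ≡ j
      +-≋-≤ {i} {j} i≤j j<n i≋j = ℕ.≤-antisym i≤j
        (ℕ.m∸n≡0⇒m≤n (small n∣j∸i (ℕ.≤-<-trans (ℕ.m∸n≤m j i) j<n)))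
        where
        n∣j∸i : n ℕ.∣ j ∸ i
        n∣j∸i = subst (n ℕ.∣_) (trans (cong ∣_∣ (ℤ.m-n≡m⊖n i j)) (ℤ.∣⊖∣-≤ i≤j)) (≋⇒≡mod i≋j)

      +-≋-< : ∀ {i j} → i < n → j < n → + i ≋ + j → i ≡ j
      +-≋-< {i} {j} i<n j<n i≋j with ℕ.≤-total i j
      ... | inj₁ i≤j = +-≋-≤ i≤j j<n i≋j
      ... | inj₂ j≤i = sym (+-≋-≤ j≤i i<n (≋-sym i≋j))

    residue-cong : ∀ {x y} → x ≋ y → residue x ≡ residue y
    residue-cong {x} {y} x≋y = Fin.toℕ-injective (+-≋-< (Fin.toℕ<n (residue x)) (Fin.toℕ<n (residue y))
      (≋-trans (toℕ-residue x) (≋-trans x≋y (≋-sym (toℕ-residue y)))))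

    residue-toℕ : ∀ i → residue (+ toℕ i) ≡ i
    residue-toℕ i = Fin.toℕ-injective (+-≋-< (Fin.toℕ<n (residue (+ toℕ i))) (Fin.toℕ<n i) (toℕ-residue (+ toℕ i)))

-- Tuples of residues encoded as single numbers.

funToFin-cong : ∀ {m n} {f g : Fin m → Fin n} → f ≗ g → funToFin f ≡ funToFin g
funToFin-cong {zero}  f≗g = refl
funToFin-cong {suc m} f≗g = cong₂ combine (f≗g zero) (funToFin-cong (f≗g ∘ suc))

funToFin-injective : ∀ {m n} {f g : Fin m → Fin n} → funToFin f ≡ funToFin g → f ≗ g
funToFin-injective {f = f} {g} eq i = trans (sym (Fin.finToFun-funToFin f i))
  (trans (cong (λ k → finToFun k i) eq) (Fin.finToFun-funToFin g i))

-- Fourier inversion modulo p with a root of unity of order s.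

module RootOfUnity
  {p} (p-prime : Prime p) {s} .{{_ : NonZero s}} (α : ℤ)
  (αˢ≋1 : Modular._≋_ p (α ℤ.^ s) 1ℤ)
  (order : ∀ d → 0 < d → d < s → ¬ Modular._≋_ p (α ℤ.^ d) 1ℤ)
  where

  open Modular p
  open import Relation.Binary.Reasoning.Setoid setoid

  private
    -- Euclid's lemma, applied to absolute values: ℤ/p has no zero divisors.
    ≋0-cancelˡ : ∀ {x y} → ¬ (x ≋ 0ℤ) → x ℤ.* y ≋ 0ℤ → y ≋ 0ℤ
    ≋0-cancelˡ {x} {y} x≢0 xy≋0 = [ (λ d → contradiction (from d) x≢0) , from ]′
      (euclidsLemma ∣ x ∣ ∣ y ∣ p-prime (subst (p ℕ.∣_) (ℤ.abs-* x y) (to xy≋0)))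
      where
      to : ∀ {z} → z ≋ 0ℤ → p ℕ.∣ ∣ z ∣
      to {z} z≋0 = subst (λ w → p ℕ.∣ ∣ w ∣) (ℤ.+-identityʳ z) (≋⇒≡mod z≋0)
      from : ∀ {z} → p ℕ.∣ ∣ z ∣ → z ≋ 0ℤ
      from {z} d = ≡mod⇒≋ (subst (λ w → p ℕ.∣ ∣ w ∣) (sym (ℤ.+-identityʳ z)) d)

    α^[sl]≋1 : ∀ l → α ℤ.^ (s ℕ.* l) ≋ 1ℤ
    α^[sl]≋1 l = ≋-trans (≋-reflexive (sym (ℤ.^-*-assoc α s l))) (^-≋1 l αˢ≋1)

  -- α ^ ((s ∸ 1) * l) plays the part of α ^ (- l).
  exponent : ℕ → ℕ → ℕ
  exponent l i = (s ∸ 1) ℕ.* l ℕ.+ i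

  private
    exponent-diagonal : ∀ l → exponent l l ≡ s ℕ.* l
    exponent-diagonal l = trans (ℕ.+-comm ((s ∸ 1) ℕ.* l) l)
      -- By computation, `l + (s ∸ 1) * l` is `suc (s ∸ 1) * l`.
      (cong (ℕ._* l) (ℕ.suc-pred s))

    exponent-+ : ∀ l i k → exponent l (i ℕ.+ k) ≡ exponent l i ℕ.+ k
    exponent-+ l i k = sym (ℕ.+-assoc ((s ∸ 1) ℕ.* l) i k)

  -- Modulo p this is α to the power `i - l`, written without negative exponents.
  character : ℕ → ℕ → ℤ
  character l i = α ℤ.^ exponent l i

  character-diagonal : ∀ l → character l l ≋ 1ℤ
  character-diagonal l rewrite exponent-diagonal l = α^[sl]≋1 l

  -- Otherwise α to the power of the distance between `i` and `l` would be 1 modulo p. That distance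
  -- is positive and below `s`, against the order of α.
  character-off-diagonal : ∀ {l i} → l < s → i < s → i ≢ l → ¬ (character l i ≋ 1ℤ)
  character-off-diagonal {l} {i} l<s i<s i≢l χ≋1 with ℕ.<-cmp i l
  ... | tri≈ _ i≡l _ = i≢l i≡l
  ... | tri< i<l _ _ = order (l ∸ i) (ℕ.m<n⇒0<n∸m i<l) (ℕ.≤-<-trans (ℕ.m∸n≤m l i) l<s) (begin
    α ℤ.^ (l ∸ i)                     ≡⟨ ℤ.*-identityˡ _ ⟨
    1ℤ ℤ.* α ℤ.^ (l ∸ i)              ≈⟨ *-congʳ χ≋1 ⟨
    character l i ℤ.* α ℤ.^ (l ∸ i)   ≡⟨ ℤ.^-distribˡ-+-* α (exponent l i) (l ∸ i) ⟨
    α ℤ.^ (exponent l i ℕ.+ (l ∸ i))  ≡⟨ cong (α ℤ.^_) (exponent-+ l i (l ∸ i)) ⟨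
    character l (i ℕ.+ (l ∸ i))       ≡⟨ cong (character l) (ℕ.m+[n∸m]≡n (ℕ.<⇒≤ i<l)) ⟩
    character l l                     ≈⟨ character-diagonal l ⟩
    1ℤ                                ∎)
  ... | tri> _ _ l<i = order (i ∸ l) (ℕ.m<n⇒0<n∸m l<i) (ℕ.≤-<-trans (ℕ.m∸n≤m i l) i<s) (begin
    α ℤ.^ (i ∸ l)                     ≡⟨ ℤ.*-identityˡ _ ⟨
    1ℤ ℤ.* α ℤ.^ (i ∸ l)              ≈⟨ *-congʳ (character-diagonal l) ⟨
    character l l ℤ.* α ℤ.^ (i ∸ l)   ≡⟨ ℤ.^-distribˡ-+-* α (exponent l l) (i ∸ l) ⟨
    α ℤ.^ (exponent l l ℕ.+ (i ∸ l))  ≡⟨ cong (α ℤ.^_) (exponent-+ l l (i ∸ l)) ⟨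
    character l (l ℕ.+ (i ∸ l))       ≡⟨ cong (character l) (ℕ.m+[n∸m]≡n (ℕ.<⇒≤ l<i)) ⟩
    character l i                     ≈⟨ χ≋1 ⟩
    1ℤ                                ∎)

  private
    sum-ones : ∀ n → sum {n} (λ _ → 1ℤ) ≡ + n
    sum-ones zero    = refl
    sum-ones (suc n) = cong (λ x → 1ℤ ℤ.+ x) (sum-ones n)

  character-sum : ℕ → ℕ → ℤ
  character-sum l i = sum {s} (λ j → character l i ℤ.^ toℕ j)

  character-sum-diagonal : ∀ l → character-sum l l ≋ + s
  character-sum-diagonal l = ≋-trans
    (ℤ/n-Sum.sum-cong-≋ {s} (λ j → ^-≋1 (toℕ j) (character-diagonal l)))
    (≋-reflexive (sum-ones s))

  -- Orthogonality of characters: multiplied by `χ - 1`, the geometric sum becomes `χ ^ s - 1`,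
  -- which vanishes modulo p, while `χ - 1` does not and can be cancelled.
  character-sum-off-diagonal : ∀ {l i} → l < s → i < s → i ≢ l → character-sum l i ≋ 0ℤ
  character-sum-off-diagonal {l} {i} l<s i<s i≢l =
    ≋0-cancelˡ (λ χ-1≋0 → character-off-diagonal l<s i<s i≢l (-≋0⇒≋ (character l i) 1ℤ χ-1≋0)) (begin
      (χ ℤ.- 1ℤ) ℤ.* character-sum l i    ≡⟨ geometric-sum χ s ⟩
      χ ℤ.^ s ℤ.- 1ℤ                      ≈⟨ ≋⇒-≋0 (χ ℤ.^ s) 1ℤ χˢ≋1 ⟩
      0ℤ                                  ∎)
    where
    χ = character l i
    χˢ≋1 : χ ℤ.^ s ≋ 1ℤ
    χˢ≋1 = begin
      χ ℤ.^ s                      ≡⟨ ℤ.^-*-assoc α (exponent l i) s ⟩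
      α ℤ.^ (exponent l i ℕ.* s)   ≡⟨ cong (α ℤ.^_) (ℕ.*-comm (exponent l i) s) ⟩
      α ℤ.^ (s ℕ.* exponent l i)   ≈⟨ α^[sl]≋1 (exponent l i) ⟩
      1ℤ                           ∎

  private
    sum-select : ∀ {n} (f : Vector ℤ n) i → (∀ j → j ≢ i → f j ≋ 0ℤ) → sum f ≋ f i
    sum-select {suc n} f i f≋0 = begin
      sum f
        ≈⟨ ℤ/n-Sum.sum-remove {i = i} f ⟩
      f i ℤ.+ sum (λ j → f (punchIn i j))
        ≈⟨ +-congˡ {f i} (ℤ/n-Sum.sum-cong-≋ (λ j → f≋0 (punchIn i j) (Fin.punchInᵢ≢i i j))) ⟩
      f i ℤ.+ sum {n} (λ _ → 0ℤ)
        ≈⟨ +-congˡ {f i} (ℤ/n-Sum.sum-replicate-zero n) ⟩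
      f i ℤ.+ 0ℤ
        ≡⟨ ℤ.+-identityʳ (f i) ⟩
      f i ∎

  -- The inverse discrete Fourier transform.
  interpolate : ∀ {κ} → + s ℤ.* κ ≋ 1ℤ → ∀ {m} → m ≤ s → (c : Vector ℤ m) →
    Σ[ a ∈ Vector ℤ s ] (∀ i → a · (λ j → α ℤ.^ (toℕ j ℕ.* toℕ i)) ≋ c i)
  interpolate {κ} sκ≋1 {m} m≤s c = a , λ i → begin
    sum (λ j → a j ℤ.* α ℤ.^ (toℕ j ℕ.* toℕ i))
      ≡⟨ ℤ-Sum.sum-cong-≗ (λ j → ℤ-Sum.*-distribʳ-sum (α ℤ.^ (toℕ j ℕ.* toℕ i)) (term j)) ⟩
    sum (λ j → sum (λ l → term j l ℤ.* α ℤ.^ (toℕ j ℕ.* toℕ i)))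
      -- With the sum over `j` innermost, each `l` contributes a multiple of a character sum.
      ≡⟨ ℤ-Sum.∑-comm {s} {m} _ ⟩
    sum (λ l → sum (λ j → term j l ℤ.* α ℤ.^ (toℕ j ℕ.* toℕ i)))
      ≡⟨ ℤ-Sum.sum-cong-≗ (λ l → ℤ-Sum.sum-cong-≗ (λ j → merge i j l)) ⟩
    sum (λ l → sum {s} (λ j → κ ℤ.* c l ℤ.* character (toℕ l) (toℕ i) ℤ.^ toℕ j))
      ≡⟨ ℤ-Sum.sum-cong-≗ (λ l → ℤ-Sum.*-distribˡ-sum {s} (κ ℤ.* c l) _) ⟨
    sum (λ l → κ ℤ.* c l ℤ.* character-sum (toℕ l) (toℕ i))
      -- Orthogonality leaves only the term `l = i`.
      ≈⟨ sum-select {m} _ i (λ l l≢i → begin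
           κ ℤ.* c l ℤ.* character-sum (toℕ l) (toℕ i)
             ≈⟨ *-congˡ {κ ℤ.* c l} (character-sum-off-diagonal (toℕ<s l) (toℕ<s i)
                  (l≢i ∘ sym ∘ Fin.toℕ-injective)) ⟩
           κ ℤ.* c l ℤ.* 0ℤ
             ≡⟨ ℤ.*-zeroʳ (κ ℤ.* c l) ⟩
           0ℤ ∎) ⟩
    κ ℤ.* c i ℤ.* character-sum (toℕ i) (toℕ i)
      ≈⟨ *-congˡ {κ ℤ.* c i} (character-sum-diagonal (toℕ i)) ⟩
    κ ℤ.* c i ℤ.* + s
      ≡⟨ rotate κ (c i) (+ s) ⟩
    + s ℤ.* κ ℤ.* c i
      ≈⟨ *-congʳ sκ≋1 ⟩
    1ℤ ℤ.* c i
      ≡⟨ ℤ.*-identityˡ (c i) ⟩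
    c i ∎
    where
    toℕ<s : (i : Fin m) → toℕ i < s
    toℕ<s i = ℕ.<-≤-trans (Fin.toℕ<n i) m≤s

    -- The factor `κ` inverts `s` modulo p and the power of α stands for the exponent `- j l`.
    -- Summing over `l` gives the inverse transform of `c` extended by zero from `m` to `s` entries.
    term : Fin s → Fin m → ℤ
    term j l = κ ℤ.* c l ℤ.* α ℤ.^ (toℕ j ℕ.* ((s ∸ 1) ℕ.* toℕ l))

    a : Vector ℤ s
    a j = sum (term j)

    rotate : ∀ x y z → x ℤ.* y ℤ.* z ≡ z ℤ.* x ℤ.* y
    rotate = solve-∀

    merge : ∀ i j l → term j l ℤ.* α ℤ.^ (toℕ j ℕ.* toℕ i)
          ≡ κ ℤ.* c l ℤ.* character (toℕ l) (toℕ i) ℤ.^ toℕ j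
    merge i j l = trans (ℤ.*-assoc (κ ℤ.* c l) _ _) (cong (κ ℤ.* c l ℤ.*_) (≡.begin
      α ℤ.^ (J ℕ.* L) ℤ.* α ℤ.^ (J ℕ.* toℕ i)  ≡.≡⟨ ℤ.^-distribˡ-+-* α (J ℕ.* L) (J ℕ.* toℕ i) ⟨
      α ℤ.^ (J ℕ.* L ℕ.+ J ℕ.* toℕ i)          ≡.≡⟨ cong (α ℤ.^_) (ℕ.*-distribˡ-+ J L (toℕ i)) ⟨
      α ℤ.^ (J ℕ.* exponent (toℕ l) (toℕ i))   ≡.≡⟨ cong (α ℤ.^_) (ℕ.*-comm J _) ⟩
      α ℤ.^ (exponent (toℕ l) (toℕ i) ℕ.* J)   ≡.≡⟨ ℤ.^-*-assoc α (exponent (toℕ l) (toℕ i)) J ⟨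
      character (toℕ l) (toℕ i) ℤ.^ J          ≡.∎))
      where
      module ≡ = ≡-Reasoning
      J = toℕ j
      L = (s ∸ 1) ℕ.* toℕ l

-- Adjusting the parity without changing residues modulo p.

perturb-sum : ∀ {s} .{{_ : NonZero s}} p (a : Vector ℤ s) δ →
  Σ[ b ∈ Vector ℤ s ] (∀ j → Modular._≋_ p (b j) (a j)) × sum b ≡ sum a ℤ.+ δ ℤ.* + p
perturb-sum {suc s} p a δ = b , b≋a , regroup (a zero) (δ ℤ.* + p) (sum (a ∘ suc))
  where
  open Modular p
  b : Vector ℤ (suc s)
  -- The whole multiple of p goes into the first coordinate, which exists because `s` is nonzero.
  b zero    = a zero ℤ.+ δ ℤ.* + p
  b (suc j) = a (suc j)
  b≋a : ∀ j → b j ≋ a j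
  b≋a zero    = ≋-trans (+-congˡ {a zero} (k*n≋0 δ)) (≋-reflexive (ℤ.+-identityʳ (a zero)))
  b≋a (suc j) = ≋-refl
  regroup : ∀ x y z → (x ℤ.+ y) ℤ.+ z ≡ (x ℤ.+ z) ℤ.+ y
  regroup = solve-∀

-- A zero remainder would make 2 a divisor of p, hence equal to 1 or to p.
odd-prime : ∀ {p} → Prime p → p ≢ 2 → p % 2 ≡ 1
odd-prime {p} p-prime p≢2 with p % 2 in eq | ℕ.m%n<n p 2
... | 0 | _ = [ (λ ()) , (λ 2≡p → contradiction (sym 2≡p) p≢2) ]′
  (prime⇒irreducible p-prime (ℕ.m%n≡0⇒n∣m p 2 eq))
... | 1 | _ = refl
... | suc (suc _) | s≤s (s≤s ())

-- The sublattice of ℤˢ and its classes.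

module Coordinates
  {p s} .{{_ : NonZero s}} (p-prime : Prime p) (p≢2 : p ≢ 2) (s∣p-1 : s ℕ.∣ p ∸ 1)
  {β : ℤ} (β-primitive : IsPrimitiveRoot p β)
  where

  private
    instance p-nonZero = prime⇒nonZero p-prime
    module P = Modular p
    module T = Modular 2
    q = (p ∸ 1) ℕ./ s

    q*s≡p-1 : q ℕ.* s ≡ p ∸ 1
    q*s≡p-1 = ℕ.m/n*n≡m s∣p-1

    1<p : 1 < p
    1<p = ℕ.nonTrivial⇒n>1 p {{prime⇒nonTrivial p-prime}}

    0<q : 0 < q
    0<q = ℕ.m≥n⇒m/n>0 (ℕ.∣⇒≤ {{ℕ.>-nonZero (ℕ.m<n⇒0<n∸m 1<p)}} s∣p-1)

    -- Since `q * s` is `p - 1`, which is -1 modulo p, the inverse of `s` is `- q`.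
    sκ≋1 : + s ℤ.* (ℤ.- + q) P.≋ 1ℤ
    sκ≋1 = P.congruent (ℤ-Signed.divides (ℤ.- 1ℤ) (begin
      + s ℤ.* (ℤ.- + q) ℤ.- 1ℤ    ≡⟨ factor (+ s) (+ q) ⟩
      ℤ.- 1ℤ ℤ.* (1ℤ ℤ.+ + q ℤ.* + s) ≡⟨ cong (λ x → ℤ.- 1ℤ ℤ.* (1ℤ ℤ.+ x)) (ℤ.pos-* q s) ⟨
      ℤ.- 1ℤ ℤ.* + suc (q ℕ.* s)   ≡⟨ cong (λ x → ℤ.- 1ℤ ℤ.* + suc x) q*s≡p-1 ⟩
      ℤ.- 1ℤ ℤ.* + suc (p ∸ 1)     ≡⟨ cong (λ x → ℤ.- 1ℤ ℤ.* + x) (ℕ.suc-pred p) ⟩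
      ℤ.- 1ℤ ℤ.* + p               ∎))
      where
      open ≡-Reasoning
      factor : ∀ x y → x ℤ.* (ℤ.- y) ℤ.- 1ℤ ≡ ℤ.- 1ℤ ℤ.* (1ℤ ℤ.+ y ℤ.* x)
      factor = solve-∀

    αˢ≋1 : α p s β ℤ.^ s P.≋ 1ℤ
    αˢ≋1 = P.≋-trans
      (P.≋-reflexive (trans (ℤ.^-*-assoc β q s) (cong (β ℤ.^_) q*s≡p-1)))
      (P.≡mod⇒≋ (proj₁ β-primitive))

    -- A power `α ^ d` is `β ^ (q * d)`, and `d < s` keeps the exponent `q * d` strictly between 0
    -- and `p - 1`.
    α-order : ∀ d → 0 < d → d < s → ¬ (α p s β ℤ.^ d P.≋ 1ℤ)
    α-order d 0<d d<s αᵈ≋1 = proj₂ β-primitive (q ℕ.* d)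
      (ℕ.*-mono-< 0<q 0<d)
      (subst (q ℕ.* d <_) q*s≡p-1 (ℕ.*-monoʳ-< q {{ℕ.>-nonZero 0<q}} d<s))
      (P.≋⇒≡mod (P.≋-trans (P.≋-reflexive (sym (ℤ.^-*-assoc β q d))) αᵈ≋1))

    p≋1 : + p T.≋ 1ℤ
    p≋1 = T.≋-trans (T.≋-sym (T.toℕ-residue (+ p)))
      (T.≋-reflexive (cong +_ (trans (Fin.toℕ-fromℕ< (n%ℕd<d (+ p) 2)) (odd-prime p-prime p≢2))))

  module _ (m : ℕ) where

    -- Common form of `𝓜̃` for both parities of `s`, with the number `m` of conditions modulo p as a
    -- parameter.
    Lattice : Vector ℤ s → Set
    Lattice a = (∀ i → i < m → a · μ p s β i ≡ 0ℤ mod p) × sum a ≡ 0ℤ mod 2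

    private
      moments : Vector ℤ s → Fin m → Fin p
      moments a i = P.residue (a · μ p s β (toℕ i))

      parity : Vector ℤ s → Fin 2
      parity a = T.residue (sum a)

    -- The homomorphism to ℤ/2 × (ℤ/p)ᵐ with kernel `Lattice`, its target numbered so that the index
    -- can be read off the type. The next two lemmas say that its fibres are the cosets of the
    -- kernel.
    class : Vector ℤ s → Fin (2 ℕ.* p ℕ.^ m)
    class a = combine (parity a) (funToFin (moments a))

    class-≡⇒lattice : ∀ a b → class a ≡ class b → Lattice (λ j → a j ℤ.- b j)
    class-≡⇒lattice a b eq = (λ i i<m → P.≋⇒≡mod (dot i i<m)) ,
      T.≋⇒≡mod (subst (T._≋ 0ℤ) (sym (sum-distrib-− a b))
        (T.≋⇒-≋0 (sum a) (sum b) (T.residue-injective parity≡)))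
      where
      parity≡ : parity a ≡ parity b
      parity≡ = Fin.combine-injectiveˡ (parity a) (funToFin (moments a)) (parity b) (funToFin (moments b)) eq
      moments≡ : moments a ≗ moments b
      moments≡ = funToFin-injective
        (Fin.combine-injectiveʳ (parity a) (funToFin (moments a)) (parity b) (funToFin (moments b)) eq)
      dot : ∀ i → i < m → (λ j → a j ℤ.- b j) · μ p s β i P.≋ 0ℤ
      dot i i<m = subst (P._≋ 0ℤ) (sym (·-distribʳ-− a b (μ p s β i)))
        (P.≋⇒-≋0 (a · μ p s β i) (b · μ p s β i)
          -- The moments are indexed by `Fin m`, so `toℕ (fromℕ< i<m)` has to be rewritten to `i`.
          (subst (λ i → a · μ p s β i P.≋ b · μ p s β i) (Fin.toℕ-fromℕ< i<m)
            (P.residue-injective (moments≡ (fromℕ< i<m)))))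

    lattice⇒class-≡ : ∀ a b → Lattice (λ j → a j ℤ.- b j) → class a ≡ class b
    lattice⇒class-≡ a b (dot≡0 , sum≡0) = cong₂ combine
      (T.residue-cong (T.-≋0⇒≋ (sum a) (sum b) (subst (T._≋ 0ℤ) (sum-distrib-− a b) (T.≡mod⇒≋ sum≡0))))
      (funToFin-cong (λ i → P.residue-cong (P.-≋0⇒≋ (a · μ p s β (toℕ i)) (b · μ p s β (toℕ i))
        (subst (P._≋ 0ℤ) (·-distribʳ-− a b (μ p s β (toℕ i))) (P.≡mod⇒≋ (dot≡0 (toℕ i) (Fin.toℕ<n i)))))))

    class-surjective : m ≤ s → ∀ k → ∃[ a ] class a ≡ k
    class-surjective m≤s k = b , trans
      (cong₂ combine parity≡ (trans (funToFin-cong moments≡) (Fin.funToFin-finToFin {m} {p} l)))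
      (proj₂ (proj₂ split))
      where
      split = Fin.combine-surjective {2} {p ℕ.^ m} k
      e = proj₁ split
      l = proj₁ (proj₂ split)

      interpolant = RootOfUnity.interpolate p-prime (α p s β) αˢ≋1 α-order sκ≋1 m≤s
        (λ i → + toℕ (finToFun l i))
      a = proj₁ interpolant

      -- As p is 1 modulo 2, adding p times the missing amount turns the parity of the sum into that
      -- of `e`, and the interpolated residues modulo p survive.
      perturbed = perturb-sum p a (+ toℕ e ℤ.- sum a)
      b = proj₁ perturbed

      moments≡ : moments b ≗ finToFun l
      moments≡ i = trans
        (P.residue-cong (P.≋-trans
          (P.ℤ/n-Sum.sum-cong-≋ {s} (λ j → P.*-cong (proj₁ (proj₂ perturbed) j) P.≋-refl))
          (proj₂ interpolant i)))
        (P.residue-toℕ (finToFun l i))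

      parity≡ : parity b ≡ e
      parity≡ = trans (T.residue-cong (begin
        sum b                                  ≡⟨ proj₂ (proj₂ perturbed) ⟩
        sum a ℤ.+ (+ toℕ e ℤ.- sum a) ℤ.* + p  ≈⟨ T.+-congˡ {sum a} (T.*-congˡ {+ toℕ e ℤ.- sum a} p≋1) ⟩
        sum a ℤ.+ (+ toℕ e ℤ.- sum a) ℤ.* 1ℤ   ≡⟨ cancel (sum a) (+ toℕ e) ⟩
        + toℕ e                                ∎))
        (T.residue-toℕ e)
        where
        open import Relation.Binary.Reasoning.Setoid T.setoid
        cancel : ∀ x y → x ℤ.+ (y ℤ.- x) ℤ.* 1ℤ ≡ y
        cancel = solve-∀

-- Transfer from coordinate vectors to the ring of integers.

/1-homo-+ : ∀ m n → (m ℤ.+ n) ℚ./ 1 ≡ m ℚ./ 1 ℚ.+ n ℚ./ 1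
-- Addition in ℚ reduces fractions; among unnormalised fractions the claim is a cross multiplication
-- with all denominators 1.
/1-homo-+ m n = ℚ.toℚᵘ-injective (begin
  ℚ.toℚᵘ ((m ℤ.+ n) ℚ./ 1)                  ≈⟨ ℚ.toℚᵘ-fromℚᵘ (mkℚᵘ (m ℤ.+ n) 0) ⟩
  mkℚᵘ (m ℤ.+ n) 0                          ≈⟨ *≡* (cross m n) ⟩
  mkℚᵘ m 0 ℚᵘ.+ mkℚᵘ n 0                    ≈⟨ ℚᵘ.+-cong (ℚ.toℚᵘ-fromℚᵘ (mkℚᵘ m 0)) (ℚ.toℚᵘ-fromℚᵘ (mkℚᵘ n 0)) ⟨
  ℚ.toℚᵘ (m ℚ./ 1) ℚᵘ.+ ℚ.toℚᵘ (n ℚ./ 1)    ≈⟨ ℚ.toℚᵘ-homo-+ (m ℚ./ 1) (n ℚ./ 1) ⟨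
  ℚ.toℚᵘ (m ℚ./ 1 ℚ.+ n ℚ./ 1)              ∎)
  where
  open import Relation.Binary.Reasoning.Setoid ℚᵘ.≃-setoid
  cross : ∀ x y → (x ℤ.+ y) ℤ.* 1ℤ ≡ (x ℤ.* 1ℤ ℤ.+ y ℤ.* 1ℤ) ℤ.* 1ℤ
  cross = solve-∀

module _
  {c ℓ₁ ℓ₂ k} (L : HeytingField c ℓ₁ ℓ₂) (ι : ℚ → HeytingField.Carrier L)
  {p ζ} (cyclotomic : IsCyclotomic L ι p ζ)
  (K : Pred (HeytingField.Carrier L) k) (subfield : IsSubfield L ι K)
  {s} {σ : HeytingField.Carrier L → HeytingField.Carrier L} {t : HeytingField.Carrier L}
  (iso : IsIsomorphismOnto𝓞 L ι K s σ t)
  where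

  private
    R : CommutativeRing c ℓ₁
    R = record { isCommutativeRing = HeytingField.isCommutativeRing L }

    module R = CommutativeRing R
    module R-Sum = Sum R.semiring
    open R using (_≈_; _-_)
    open IsIsomorphismOnto𝓞 iso

    φ : Vector ℤ s → R.Carrier
    φ = fromCoordinates L ι σ t

    ιℤ-homo-+ : ∀ m n → ιℤ L ι (m ℤ.+ n) ≈ ιℤ L ι m R.+ ιℤ L ι n
    ιℤ-homo-+ m n = R.trans (R.reflexive (cong ι (/1-homo-+ m n)))
      (IsRingHomomorphism.+-homo (IsCyclotomic.ι-homomorphism cyclotomic) (m ℚ./ 1) (n ℚ./ 1))

    -- Additivity of `ιℤ` suffices: applied to `(a - b) + b` it splits `φ a` as `φ (a - b) + φ b`,
    -- and `φ b` is then cancelled.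
    φ-homo-− : ∀ a b → φ (λ i → a i ℤ.- b i) ≈ φ a - φ b
    φ-homo-− a b = R.sym (begin
      φ a - φ b                             ≈⟨ R.+-congʳ (R-Sum.sum-cong-≋ {s} split) ⟩
      R-Sum.sum (λ i → ιℤ L ι (a i ℤ.- b i) R.* θⁱt i R.+ ιℤ L ι (b i) R.* θⁱt i) - φ b
                                            ≈⟨ R.+-congʳ (R-Sum.∑-distrib-+ {s} _ _) ⟩
      φ (λ i → a i ℤ.- b i) R.+ φ b - φ b     ≈⟨ //-rightDividesʳ (φ b) _ ⟩
      φ (λ i → a i ℤ.- b i)                 ∎)
      where
      open import Relation.Binary.Reasoning.Setoid R.setoid
      open import Algebra.Properties.Group R.+-group using (//-rightDividesʳ)
      θⁱt : Fin s → R.Carrier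
      θⁱt i = iterate σ t (toℕ i)
      recombine : ∀ x y → (x ℤ.- y) ℤ.+ y ≡ x
      recombine = solve-∀
      split : ∀ i → ιℤ L ι (a i) R.* θⁱt i ≈ ιℤ L ι (a i ℤ.- b i) R.* θⁱt i R.+ ιℤ L ι (b i) R.* θⁱt i
      split i = begin
        ιℤ L ι (a i) R.* θⁱt i
          ≡⟨ cong (λ x → ιℤ L ι x R.* θⁱt i) (recombine (a i) (b i)) ⟨
        ιℤ L ι ((a i ℤ.- b i) ℤ.+ b i) R.* θⁱt i
          ≈⟨ R.*-congʳ (ιℤ-homo-+ (a i ℤ.- b i) (b i)) ⟩
        (ιℤ L ι (a i ℤ.- b i) R.+ ιℤ L ι (b i)) R.* θⁱt i
          ≈⟨ R.distribʳ _ _ _ ⟩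
        ιℤ L ι (a i ℤ.- b i) R.* θⁱt i R.+ ιℤ L ι (b i) R.* θⁱt i ∎

    coordinates : ∃ (𝓞 L ι K) → Vector ℤ s
    coordinates x = proj₁ (proj₂ bijective x)

    φ-coordinates : ∀ x → φ (coordinates x) ≈ proj₁ x
    -- Surjectivity speaks of every vector pointwise equal to the chosen preimage; reflexivity
    -- selects the preimage itself.
    φ-coordinates x = proj₂ (proj₂ bijective x) (λ _ → refl)

    coordinates-− : ∀ x y → φ (λ i → coordinates x i ℤ.- coordinates y i) ≈ proj₁ x - proj₁ y
    coordinates-− x y = R.trans (φ-homo-− (coordinates x) (coordinates y))
      (R.+-cong (φ-coordinates x) (R.-‿cong (φ-coordinates y)))

    𝓞-resp-≈ : ∀ {x y} → x ≈ y → 𝓞 L ι K x → 𝓞 L ι K y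
    𝓞-resp-≈ x≈y (x∈K , n , a , x-root) = IsSubfield.≈-closed subfield x≈y x∈K , n , a ,
      R.trans (R.sym (R.+-cong (^-congˡ n x≈y)
        (R-Sum.sum-cong-≋ {n} (λ i → R.*-congˡ (^-congˡ (toℕ i) x≈y))))) x-root
      where
      open import Algebra.Properties.Semiring.Exp R.semiring using (^-congˡ)

  -- Composing with `coordinates` carries a surjection from ℤˢ whose fibres are the cosets of `N`
  -- over to `𝓞 K`. Vectors are functions determined only up to pointwise equality, so `N` must
  -- respect it.
  hasIndex : ∀ {r} {N : Pred (Vector ℤ s) r} → (∀ {a b} → a ≗ b → N a → N b) →
    ∀ {n} (f : Vector ℤ s → Fin n) →
    (∀ a b → f a ≡ f b → N (λ i → a i ℤ.- b i)) →
    (∀ a b → N (λ i → a i ℤ.- b i) → f a ≡ f b) →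
    (∀ j → ∃[ a ] f a ≡ j) →
    HasIndex L ι (𝓞 L ι K) (⟦_⟧ L ι N K σ t) n
  hasIndex {N = N} N-resp f f≡⇒N N⇒f≡ f-surjective =
    f ∘ coordinates , (λ {x y} → congruent x y) , (λ {x y} → injective x y) , surjective
    where
    φ-injective : ∀ a b → φ a ≈ φ b → a ≗ b
    φ-injective a b = proj₁ bijective {a} {b}

    congruent : ∀ x y → ⟦_⟧ L ι N K σ t (proj₁ x - proj₁ y) → f (coordinates x) ≡ f (coordinates y)
    congruent x y (_ , a , x-y≈φa , a∈N) = N⇒f≡ (coordinates x) (coordinates y)
      -- Membership supplies some vector `a` in `N`; injectivity of `φ` identifies it with the
      -- difference of the coordinates.
      (N-resp (φ-injective a (λ i → coordinates x i ℤ.- coordinates y i)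
        (R.trans (R.sym x-y≈φa) (R.sym (coordinates-− x y)))) a∈N)

    injective : ∀ x y → f (coordinates x) ≡ f (coordinates y) → ⟦_⟧ L ι N K σ t (proj₁ x - proj₁ y)
    injective x y eq =
      𝓞-resp-≈ (coordinates-− x y) (integral (λ i → coordinates x i ℤ.- coordinates y i)) ,
      _ , R.sym (coordinates-− x y) , f≡⇒N (coordinates x) (coordinates y) eq

    surjective : ∀ j → Σ[ x ∈ ∃ (𝓞 L ι K) ]
      (∀ {y} → ⟦_⟧ L ι N K σ t (proj₁ y - proj₁ x) → f (coordinates y) ≡ j)
    surjective j with a , fa≡j ← f-surjective j =
      x , λ {y} y-x∈N → trans (congruent y x y-x∈N)
            (trans (N⇒f≡ (coordinates x) a coordinates-x-a∈N) fa≡j)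
      where
      x : ∃ (𝓞 L ι K)
      x = φ a , integral a
      coordinates-x≗a : coordinates x ≗ a
      coordinates-x≗a = φ-injective (coordinates x) a (φ-coordinates x)
      coordinates-x-a∈N : N (λ i → coordinates x i ℤ.- a i)
      -- Here `f≡⇒N a a refl` places `a - a` in `N`.
      coordinates-x-a∈N = N-resp (λ i → cong (ℤ._- a i) (sym (coordinates-x≗a i))) (f≡⇒N a a refl)

-- Counting the conditions modulo p, and the index.

1+[s-1]/2≡[s+1]/2 : ∀ s .{{_ : NonZero s}} → suc ((s ∸ 1) ℕ./ 2) ≡ (s ℕ.+ 1) ℕ./ 2
1+[s-1]/2≡[s+1]/2 (suc s) = trans (sym (ℕ.m/n≡1+[m∸n]/n {2 ℕ.+ s} {2} (s≤s (s≤s z≤n))))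
  (cong (ℕ._/ 2) (ℕ.+-comm 1 (suc s)))

-- For even `s` the conditions run over the indices from 0 to `s / 2` inclusive, one more than the
-- last index.
1+s/2≡[s+2]/2 : ∀ s → suc (s ℕ./ 2) ≡ (s ℕ.+ 2) ℕ./ 2
1+s/2≡[s+2]/2 s = trans (sym (ℕ.m/n≡1+[m∸n]/n {2 ℕ.+ s} {2} (s≤s (s≤s z≤n))))
  (cong (ℕ._/ 2) (ℕ.+-comm 2 s))

-- Interpolation can prescribe at most `s` moments; the cases `k = 1` and `k = 2` bound their number
-- for odd and even `s`.
[s+k]/2≤s : ∀ {s k} → k ≤ s → (s ℕ.+ k) ℕ./ 2 ≤ s
[s+k]/2≤s {s} {k} k≤s = begin
  (s ℕ.+ k) ℕ./ 2 ≤⟨ ℕ./-monoˡ-≤ 2 (ℕ.+-monoʳ-≤ s k≤s) ⟩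
  (s ℕ.+ s) ℕ./ 2 ≡⟨ cong (ℕ._/ 2) (cong (s ℕ.+_) (ℕ.+-identityʳ s)) ⟨
  (2 ℕ.* s) ℕ./ 2 ≡⟨ cong (ℕ._/ 2) (ℕ.*-comm 2 s) ⟩
  (s ℕ.* 2) ℕ./ 2 ≡⟨ ℕ.m*n/n≡m s 2 ⟩
  s               ∎
  where
  open ℕ.≤-Reasoning

corollary18 : ∀ {c ℓ₁ ℓ₂ k} (p s : ℕ) .{{_ : NonZero s}} →
    Prime p → p ≢ 2 → s ∣ p ∸ 1 →
    (L : HeytingField c ℓ₁ ℓ₂) (ι : ℚ → HeytingField.Carrier L) (ζ : HeytingField.Carrier L) →
    IsCyclotomic L ι p ζ →
    (K : Pred (HeytingField.Carrier L) k) →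
    IsSubfield L ι K → HasDegreeOverℚ L ι K s →
    (u : ℤ) → GeneratesUnits p u →
    (σ : HeytingField.Carrier L → HeytingField.Carrier L) →
    IsGaloisAutomorphism L ι p ζ u σ →
    (t : HeytingField.Carrier L) → IsTrace L ι K ζ t →
    IsIsomorphismOnto𝓞 L ι K s σ t →
    (β : ℤ) → IsPrimitiveRoot p β →
    (s % 2 ≡ 1 →
    HasIndex L ι (𝓞 L ι K) (⟦_⟧ L ι (𝓜̃ p s β) K σ t) (2 * p ^ ((s + 1) / 2))) ×
    (s % 2 ≡ 0 →
    HasIndex L ι (𝓞 L ι K) (⟦_⟧ L ι (𝓜̃ p s β) K σ t) (2 * p ^ ((s + 2) / 2)))
corollary18 p s p-prime p≢2 s∣p-1 L ι ζ cyclotomic K subfield _ u _ σ _ t _ iso β β-primitive =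
  (λ odd →
    index (1+[s-1]/2≡[s+1]/2 s) ([s+k]/2≤s (ℕ.>-nonZero⁻¹ s))
      (λ { ((dot , _) , even-sum) → dot odd , even-sum })
      -- The clause of `𝓜` for even `s` holds vacuously.
      (λ { (dot , even-sum) → ((λ _ → dot) , λ even → contradiction (trans (sym odd) even) λ ()) , even-sum })) ,
  (λ even →
    index (1+s/2≡[s+2]/2 s) ([s+k]/2≤s (2≤s even))
      (λ { ((_ , dot) , even-sum) → dot even , even-sum })
      (λ { (dot , even-sum) → ((λ odd → contradiction (trans (sym odd) even) λ ()) , λ _ → dot) , even-sum }))
  where
  open Coordinates p-prime p≢2 s∣p-1 β-primitive

  2≤s : s % 2 ≡ 0 → 2 ≤ s
  2≤s even = ℕ.∣⇒≤ (ℕ.m%n≡0⇒n∣m s 2 even)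

  𝓜̃-resp : ∀ {a b} → a ≗ b → 𝓜̃ p s β a → 𝓜̃ p s β b
  𝓜̃-resp a≗b ((dot₁ , dot₂) , even-sum) =
    ( (λ odd i i≤ → subst (λ x → x ≡ 0ℤ mod p) (·-cong i) (dot₁ odd i i≤))
    , (λ even i i≤ → subst (λ x → x ≡ 0ℤ mod p) (·-cong i) (dot₂ even i i≤)) )
    , subst (λ x → x ≡ 0ℤ mod 2) (ℤ-Sum.sum-cong-≗ a≗b) even-sum
    where
    ·-cong = λ i → ℤ-Sum.sum-cong-≗ {s} (λ j → cong (ℤ._* μ p s β i j) (a≗b j))

  -- Handles both parities at once: `h` is the last index among the conditions, so `i ≤ h` becomes
  -- `i < suc h` in `Lattice`.
  index : ∀ {h m} → suc h ≡ m → m ≤ s →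
    (∀ {a} → 𝓜̃ p s β a → (∀ i → i ≤ h → a · μ p s β i ≡ 0ℤ mod p) × sum a ≡ 0ℤ mod 2) →
    (∀ {a} → (∀ i → i ≤ h → a · μ p s β i ≡ 0ℤ mod p) × sum a ≡ 0ℤ mod 2 → 𝓜̃ p s β a) →
    HasIndex L ι (𝓞 L ι K) (⟦_⟧ L ι (𝓜̃ p s β) K σ t) (2 * p ^ m)
  index {h} refl m≤s to from = hasIndex L ι cyclotomic K subfield iso 𝓜̃-resp (class (suc h))
    (λ a b eq → let dot , even-sum = class-≡⇒lattice (suc h) a b eq in
      from ((λ i i≤h → dot i (s≤s i≤h)) , even-sum))
    (λ a b a-b∈𝓜̃ → let dot , even-sum = to a-b∈𝓜̃ in
      lattice⇒class-≡ (suc h) a b ((λ { i (s≤s i≤h) → dot i i≤h }) , even-sum))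
    (class-surjective (suc h) m≤s)
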